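{- Let $m,n,\ell$ be integers such that $m\ge 1$, $n\ge 4$ is even, $0\le\ell\le n/2$ and $\ell\equiv m\pmod 2$, and let $X=\mathrm{HTG}(m,n,\ell)$. Then $X$ is a 3-RDR graph if and only if either $m$ is even and $n\equiv\ell\equiv 0\pmod 6$, or $m$ is odd, $n\equiv 0\pmod 6$ and $\ell\equiv 3\pmod 6$.
   Context: All graphs are finite and simple. For a graph $G=(V,E)$, $N(v)$ is the open neighbourhood of $v$. A $3$-rainbow dominating function (3-RDF) on $G$ is a map $f\colon V\to 2^{\{1,2,3\}}$ such that $f(v)=\emptyset$ implies $\bigcup_{u\in N(v)}f(u)=\{1,2,3\}$, for all $v\in V$; $\gamma_{r3}(G)$ is the minimum of $\sum_{v}|f(v)|$ over all 3-RDFs. A cubic (3-regular) graph $G$ is 3-RDR (3-rainbow domination regular) if $\gamma_{r3}(G)=|V|/2$ (the known lower bound for cubic graphs). For integers $m\ge1$, even $n\ge4$, and $0\le\ell\le n/2$ with $\ell\equiv m\pmod 2$, the honeycomb toroidal graph $\mathrm{HTG}(m,n,\ell)$ has vertex set $\{v_{i,j}: i\in\mathbb Z_m, j\in\mathbb Z_n\}$ and edge set the disjoint union of: vertical edges $\{v_{i,j},v_{i,j+1}\}$ for $i\in\mathbb Z_m$, $j\in\mathbb Z_n$; horizontal edges $\{v_{i,j},v_{i+1,j}\}$ for $i\in\mathbb Z_m\setminus\{m-1\}$, $j\in\mathbb Z_n$, $i+1\equiv j\pmod 2$; and jumps $\{v_{m-1,j},v_{0,j+\ell}\}$ for $j\in\mathbb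 Z_n$, $j\equiv m\pmod 2$. -}

module Defs where

open import Data.Fin.Base using (Fin; toℕ)
import Data.Fin.Properties as Fin
open import Data.Fin.Subset using (Subset; ⊥; ⊤; ⋃; ∣_∣)
open import Data.List.Base using (List; length; map; filter; tabulate; sum)
open import Data.Nat.Base
  using (ℕ; suc; _+_; _*_; _≤_; _<_; _/_; _%_; NonZero; >-nonZero; s≤s; z≤n)
open import Data.Nat.Divisibility using (_∣_)
open import Data.Nat.DivMod using (_mod_; m∣n⇒o%n%m≡o%m; m%n<n; %-distribˡ-+)
import Data.Nat.Properties as ℕ
open import Data.Product.Base using (_×_; _,_; ∃-syntax)
open import Data.Sum.Base using (_⊎_; inj₁; inj₂; [_,_]; swap)
open import Function.Bundles using (_↔_; Inverse)
open import Relation.Binary.Core using (Rel)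
open import Relation.Binary.Definitions using (Decidable; Symmetric)
open import Relation.Binary.PropositionalEquality
  using (_≡_; _≢_; refl; sym; trans; cong; module ≡-Reasoning)
open import Relation.Nullary.Decidable using (_×-dec_; _⊎-dec_)
open import Relation.Nullary.Negation using (¬_)
open import Level using (0ℓ)

infix 4 _≈_[mod_]

_≈_[mod_] : ℕ → ℕ → (k : ℕ) → .{{NonZero k}} → Set
a ≈ b [mod k ] = a % k ≡ b % k

record Graph : Set₁ where
  infix 4 _~_ _~?_
  field
    V        : Set
    order    : ℕ
    enum     : Fin order ↔ V
    _~_      : Rel V 0ℓ
    _~?_     : Decidable _~_
    ~-sym    : Symmetric _~_
    ~-irrefl : ∀ v → ¬ (v ~ v)

  vertices : List V
  vertices = tabulate (Inverse.to enum)

  neighbours : V → List V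
  neighbours v = filter (v ~?_) vertices

module _ (G : Graph) where
  open Graph G

  Cubic : Set
  Cubic = ∀ v → length (neighbours v) ≡ 3

  -- The colours {1,2,3} are represented by Fin 3; ⊥ and ⊤ are the empty and
  -- the full colour set.
  Is3RDF : (V → Subset 3) → Set
  Is3RDF f = ∀ v → f v ≡ ⊥ → ⋃ (map f (neighbours v)) ≡ ⊤

  weight : (V → Subset 3) → ℕ
  weight f = sum (map (λ v → ∣ f v ∣) vertices)

  -- γ_{r3}(G) = k, the minimum being expressed as an attained lower bound.
  record Isγr3 (k : ℕ) : Set where
    field
      attained : ∃[ f ] (Is3RDF f × weight f ≡ k)
      minimal  : ∀ f → Is3RDF f → k ≤ weight f

  record Is3RDR : Set where
    field
      cubic  : Cubic
      γr3    : ℕ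
      isγr3  : Isγr3 γr3
      halved : 2 * γr3 ≡ order

record Admissible (m n ℓ : ℕ) : Set where
  field
    m≥1    : 1 ≤ m
    n≥4    : 4 ≤ n
    n-even : 2 ∣ n
    ℓ≤n/2  : ℓ ≤ n / 2
    ℓ≡m    : ℓ ≈ m [mod 2 ]

-- ℤₘ and ℤₙ are represented by Fin m and Fin n.  Each relation orients its
-- edges as in {v_{i,j}, v_{i′,j′}}; adjacency is the symmetric closure.
module _ (m n ℓ : ℕ) .{{_ : NonZero n}} where

  Vertical : Rel (Fin m × Fin n) 0ℓ
  Vertical (i , j) (i′ , j′) = i′ ≡ i × j′ ≡ (toℕ j + 1) mod n

  -- i ≠ m - 1 is implied, as i′ is the non-wrapping successor of i.
  Horizontal : Rel (Fin m × Fin n) 0ℓ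
  Horizontal (i , j) (i′ , j′) =
    toℕ i′ ≡ toℕ i + 1 × j′ ≡ j × toℕ i + 1 ≈ toℕ j [mod 2 ]

  Jump : Rel (Fin m × Fin n) 0ℓ
  Jump (i , j) (i′ , j′) =
    toℕ i + 1 ≡ m × toℕ i′ ≡ 0 × j′ ≡ (toℕ j + ℓ) mod n × toℕ j ≈ m [mod 2 ]

  Edge : Rel (Fin m × Fin n) 0ℓ
  Edge u v = Vertical u v ⊎ Horizontal u v ⊎ Jump u v

  edge? : Decidable Edge
  edge? (i , j) (i′ , j′) =
    (i′ Fin.≟ i ×-dec j′ Fin.≟ (toℕ j + 1) mod n)
    ⊎-dec
    (toℕ i′ ℕ.≟ toℕ i + 1 ×-dec j′ Fin.≟ j
      ×-dec (toℕ i + 1) % 2 ℕ.≟ toℕ j % 2)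
    ⊎-dec
    (toℕ i + 1 ℕ.≟ m ×-dec toℕ i′ ℕ.≟ 0 ×-dec j′ Fin.≟ (toℕ j + ℓ) mod n
      ×-dec toℕ j % 2 ℕ.≟ m % 2)

  mod-parity : 2 ∣ n → ∀ a → toℕ (a mod n) ≈ a [mod 2 ]
  mod-parity 2∣n a =
    trans (cong (_% 2) (Fin.toℕ-fromℕ< (m%n<n a n))) (m∣n⇒o%n%m≡o%m 2 n a 2∣n)

  odd-shift : 2 ∣ n → ∀ (j : Fin n) d → d % 2 ≡ 1 → j ≢ (toℕ j + d) mod n
  odd-shift 2∣n j d d-odd j≡j+d = flips (toℕ j % 2) (m%n<n (toℕ j) 2) (begin
      toℕ j % 2                        ≡⟨ cong (λ k → toℕ k % 2) j≡j+d ⟩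
      toℕ ((toℕ j + d) mod n) % 2      ≡⟨ mod-parity 2∣n (toℕ j + d) ⟩
      (toℕ j + d) % 2                  ≡⟨ %-distribˡ-+ (toℕ j) d 2 ⟩
      (toℕ j % 2 + d % 2) % 2          ≡⟨ cong (λ r → (toℕ j % 2 + r) % 2) d-odd ⟩
      (toℕ j % 2 + 1) % 2              ∎)
    where
    open ≡-Reasoning
    flips : ∀ r → r < 2 → ¬ (r ≡ (r + 1) % 2)
    flips 0 _ ()
    flips 1 _ ()
    flips (suc (suc _)) (s≤s (s≤s ()))

  edge-irrefl : 2 ∣ n → ℓ ≈ m [mod 2 ] → ∀ v → ¬ Edge v v
  edge-irrefl 2∣n _ (i , j) (inj₁ (_ , j≡j+1)) = odd-shift 2∣n j 1 refl j≡j+1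
  edge-irrefl _ _ (i , j) (inj₂ (inj₁ (i≡i+1 , _))) =
    ℕ.m≢1+m+n (toℕ i) (trans i≡i+1 (trans (ℕ.+-comm (toℕ i) 1) (cong suc (sym (ℕ.+-identityʳ _)))))
  edge-irrefl 2∣n ℓ≡m (i , j) (inj₂ (inj₂ (i+1≡m , i≡0 , j≡j+ℓ , _))) =
    odd-shift 2∣n j ℓ
      (trans ℓ≡m (cong (_% 2) (trans (sym i+1≡m) (cong (_+ 1) i≡0)))) j≡j+ℓ

-- For m = 1 and ℓ = 1 the jumps coincide with vertical edges, so that this
-- simple graph is a cycle of length n; otherwise it is cubic.
HTG : (m n ℓ : ℕ) → Admissible m n ℓ → Graph
HTG m n ℓ adm = record
  { V        = Fin m × Fin n
  ; order    = m * n
  ; enum     = Fin.*↔×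
  ; _~_      = λ u v → Edge m n ℓ u v ⊎ Edge m n ℓ v u
  ; _~?_     = λ u v → edge? m n ℓ u v ⊎-dec edge? m n ℓ v u
  ; ~-sym    = swap
  ; ~-irrefl = λ v → [ edge-irrefl m n ℓ n-even ℓ≡m v , edge-irrefl m n ℓ n-even ℓ≡m v ]
  }
  where
  open Admissible adm
  instance
    n≢0 : NonZero n
    n≢0 = >-nonZero (ℕ.≤-trans (s≤s z≤n) n≥4)

{-# OPTIONS --safe #-}

-- Write g = ∣f∣ and let each vertex v receive
-- g(v₁) + g(v₂) + g(v₃) + 3 g(v), where v₁, v₂, v₃ are its neighbours.
-- A 3-RDF gives every vertex at least 3, while the total is 6 w(f); hence
-- 2 w(f) ≥ |V|, with equality iff every vertex receives exactly 3.  In that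
-- case the coloured vertices carry one colour each, they form one side of the
-- bipartition, and every empty vertex sees all three colours.
-- Two consecutive empty vertices of a column are joined horizontally to
-- vertices with a common empty neighbour, which forces the colours on a column
-- to have period 6 and the next column to be the same sequence shifted by 3.
-- Going once around the torus gives 6 ∣ n and 6 ∣ 3m + ℓ.  Conversely, under
-- these conditions v_{i,j} ↦ j + 3i mod 6 is a covering of K₃,₃ (the circulant
-- graph on ℤ₆ with connection set {1, 3, 5}), along which an optimal colouring
-- of K₃,₃ is pulled back.

module Submission where

import Data.Bool.Properties as Bool
open import Data.Empty using (⊥-elim)
open import Data.Fin.Base using (Fin; zero; suc; toℕ; fromℕ; inject₁)
open import Data.Fin.Induction using (<-weakInduction)
import Data.Fin.Properties as Fin
open import Data.Fin.Relation.Unary.Top using (View; ‵fromℕ; ‵inj₁; view; view-fromℕ; view-inject₁)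
open import Data.Fin.Subset using (Subset; inside; outside; ⊥; ⊤; ⁅_⁆; _∪_; ⋃; ∣_∣; _∈_; _⊆_)
open import Data.Fin.Subset.Properties
  using (∣⁅x⁆∣≡1; ∉⊥; x∈⁅x⁆; x∈⁅y⁆⇒x≡y; x∈p∪q⁻; x∈p∪q⁺; ⊆-antisym)
open import Data.List.Base using (List; []; _∷_; length; map)
open import Data.List.Membership.Propositional using () renaming (_∈_ to _∈ₗ_)
open import Data.List.Membership.Propositional.Properties
  using (∈-map⁺; ∈-tabulate⁺; ∈-filter⁺; ∈-filter⁻)
open import Data.List.Membership.Propositional.Properties.WithK using (unique∧set⇒bag)
open import Data.List.Properties using (length-tabulate; map-∘; map-cong)
open import Data.List.Relation.Binary.BagAndSetEquality using (∼bag⇒↭)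
open import Data.List.Relation.Binary.Permutation.Propositional using (_↭_)
open import Data.List.Relation.Binary.Permutation.Propositional.Properties using (↭-length; map⁺)
open import Data.List.Relation.Unary.All using ([]; _∷_)
open import Data.List.Relation.Unary.AllPairs using ([]; _∷_)
open import Data.List.Relation.Unary.Any using (here; there)
open import Data.List.Relation.Unary.Unique.Propositional using (Unique)
import Data.List.Relation.Unary.Unique.Propositional.Properties as Unique
open import Data.Nat.Base
open import Data.Nat.Divisibility using (_∣_; m%n≡0⇒n∣m)
open import Data.Nat.DivMod
open import Data.Nat.ListAction using (sum)
open import Data.Nat.ListAction.Properties using (sum-↭)
open import Data.Nat.Properties
open import Data.Nat.Solver using (module +-*-Solver)
open import Data.Parity.Base using (Parity; 0ℙ; 1ℙ) renaming (_⁻¹ to opp; _+_ to _⊕_)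
import Data.Parity.Properties as ℙ
open import Data.Product.Base using (_×_; _,_; proj₁; proj₂; ∃-syntax)
open import Data.Sum.Base using (_⊎_; inj₁; inj₂; [_,_]′)
open import Data.Vec.Base using ([]; _∷_)
open import Data.Vec.Properties using (≡-dec)
open import Function.Base using (_∘_)
open import Function.Bundles using (_⇔_; mk⇔; Inverse)
open import Relation.Binary.PropositionalEquality
open import Relation.Nullary.Decidable using (from-yes; ¬?; _→-dec_; _×-dec_)
open import Relation.Nullary.Negation using (¬_; contradiction)
open import Defs

private variable
  k : ℕ
  A : Set

-- Congruences modulo 6, and cardinalities and unions of finite subsets.

%-congˡ-+ : ∀ c a b → a ≈ b [mod 6 ] → c + a ≈ c + b [mod 6 ]
%-congˡ-+ c a b eq = begin
  (c + a) % 6            ≡⟨ %-distribˡ-+ c a 6 ⟩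
  (c % 6 + a % 6) % 6    ≡⟨ cong (λ r → (c % 6 + r) % 6) eq ⟩
  (c % 6 + b % 6) % 6    ≡⟨ %-distribˡ-+ c b 6 ⟨
  (c + b) % 6            ∎
  where open ≡-Reasoning

%-congʳ-+ : ∀ c a b → a ≈ b [mod 6 ] → a + c ≈ b + c [mod 6 ]
%-congʳ-+ c a b eq =
  trans (cong (_% 6) (+-comm a c)) (trans (%-congˡ-+ c a b eq) (cong (_% 6) (+-comm c b)))

∣p∣≡0⇒p≡⊥ : (p : Subset k) → ∣ p ∣ ≡ 0 → p ≡ ⊥
∣p∣≡0⇒p≡⊥ []            _  = refl
∣p∣≡0⇒p≡⊥ (outside ∷ p) eq = cong (outside ∷_) (∣p∣≡0⇒p≡⊥ p eq)

∣p∣≡1⇒p≡⁅x⁆ : (p : Subset k) → ∣ p ∣ ≡ 1 → ∃[ x ] p ≡ ⁅ x ⁆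
∣p∣≡1⇒p≡⁅x⁆ (inside  ∷ p) eq = zero , cong (inside ∷_) (∣p∣≡0⇒p≡⊥ p (suc-injective eq))
∣p∣≡1⇒p≡⁅x⁆ (outside ∷ p) eq with x , refl ← ∣p∣≡1⇒p≡⁅x⁆ p eq = suc x , refl

∣p∪q∣≤∣p∣+∣q∣ : (p q : Subset k) → ∣ p ∪ q ∣ ≤ ∣ p ∣ + ∣ q ∣
∣p∪q∣≤∣p∣+∣q∣ []            []            = z≤n
∣p∪q∣≤∣p∣+∣q∣ (outside ∷ p) (outside ∷ q) = ∣p∪q∣≤∣p∣+∣q∣ p q
∣p∪q∣≤∣p∣+∣q∣ (inside  ∷ p) (outside ∷ q) = s≤s (∣p∪q∣≤∣p∣+∣q∣ p q)
∣p∪q∣≤∣p∣+∣q∣ (outside ∷ p) (inside  ∷ q) =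
  ≤-trans (s≤s (∣p∪q∣≤∣p∣+∣q∣ p q)) (≤-reflexive (sym (+-suc ∣ p ∣ ∣ q ∣)))
∣p∪q∣≤∣p∣+∣q∣ (inside  ∷ p) (inside  ∷ q) =
  s≤s (≤-trans (∣p∪q∣≤∣p∣+∣q∣ p q) (+-monoʳ-≤ ∣ p ∣ (n≤1+n ∣ q ∣)))

∈-⋃⁺ : {x : Fin k} {p : Subset k} {ps : List (Subset k)} → p ∈ₗ ps → x ∈ p → x ∈ ⋃ ps
∈-⋃⁺ (here refl) x∈p = x∈p∪q⁺ (inj₁ x∈p)
∈-⋃⁺ (there p∈)  x∈p = x∈p∪q⁺ (inj₂ (∈-⋃⁺ p∈ x∈p))

⋃-map-mono : (f : A → Subset k) {xs ys : List A} →
             (∀ {x} → x ∈ₗ xs → x ∈ₗ ys) → ⋃ (map f xs) ⊆ ⋃ (map f ys)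
⋃-map-mono f {xs} {ys} xs⊆ys c∈ = go xs xs⊆ys c∈
  where
  go : ∀ zs → (∀ {x} → x ∈ₗ zs → x ∈ₗ ys) → ∀ {c} → c ∈ ⋃ (map f zs) → c ∈ ⋃ (map f ys)
  go []       _    c∈ = ⊥-elim (∉⊥ c∈)
  go (z ∷ zs) zs⊆ c∈ with x∈p∪q⁻ (f z) (⋃ (map f zs)) c∈
  ... | inj₁ c∈fz = ∈-⋃⁺ (∈-map⁺ f (zs⊆ (here refl))) c∈fz
  ... | inj₂ c∈⋃  = go zs (zs⊆ ∘ there) c∈⋃

-- Lists up to permutation, and sums over them.

unique∧set⇒↭ : {xs ys : List A} → Unique xs → Unique ys →
               (∀ {x} → x ∈ₗ xs → x ∈ₗ ys) → (∀ {x} → x ∈ₗ ys → x ∈ₗ xs) → xs ↭ ys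
unique∧set⇒↭ xs! ys! xs⊆ys ys⊆xs = ∼bag⇒↭ (unique∧set⇒bag xs! ys! (mk⇔ xs⊆ys ys⊆xs))

sum-map-+ : (f g : A → ℕ) (xs : List A) →
            sum (map (λ x → f x + g x) xs) ≡ sum (map f xs) + sum (map g xs)
sum-map-+ f g []       = refl
sum-map-+ f g (x ∷ xs) rewrite sum-map-+ f g xs =
  solve 4 (λ a b c d → a :+ b :+ (c :+ d) := a :+ c :+ (b :+ d)) refl
        (f x) (g x) (sum (map f xs)) (sum (map g xs))
  where open +-*-Solver

sum-map-* : (c : ℕ) (f : A → ℕ) (xs : List A) → sum (map (λ x → c * f x) xs) ≡ c * sum (map f xs)
sum-map-* c f []       = sym (*-zeroʳ c)
sum-map-* c f (x ∷ xs) rewrite sum-map-* c f xs = sym (*-distribˡ-+ c (f x) (sum (map f xs)))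

sum-map-const : (c : ℕ) (xs : List A) → sum (map (λ _ → c) xs) ≡ length xs * c
sum-map-const c []       = refl
sum-map-const c (x ∷ xs) = cong (c +_) (sum-map-const c xs)

length*≤sum-map : {c : ℕ} {f : A → ℕ} → (∀ x → c ≤ f x) → (xs : List A) → length xs * c ≤ sum (map f xs)
length*≤sum-map c≤f []       = z≤n
length*≤sum-map c≤f (x ∷ xs) = +-mono-≤ (c≤f x) (length*≤sum-map c≤f xs)

-- No summand lies below `c`, so an excess at one entry could not be made up for at another.
sum-map≡length* : {c : ℕ} {f : A → ℕ} → (∀ x → c ≤ f x) → (xs : List A) →
                  sum (map f xs) ≡ length xs * c → ∀ {x} → x ∈ₗ xs → f x ≡ c
sum-map≡length* {c = c} {f} c≤f (y ∷ xs) eq = λ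
  { (here refl) → fy≡c
  ; (there x∈)  → sum-map≡length* c≤f xs
      (+-cancelˡ-≡ c _ _ (trans (cong (_+ sum (map f xs)) (sym fy≡c)) eq)) x∈
  }
  where
  fy≡c : f y ≡ c
  fy≡c = ≤-antisym
    (+-cancelʳ-≤ (sum (map f xs)) (f y) c
      (≤-trans (≤-reflexive eq) (+-monoʳ-≤ c (length*≤sum-map c≤f xs))))
    (c≤f y)

-- Colour sets at a vertex and its three neighbours.

rainbow⇒distinct : ∀ (x y z : Fin 3) → ⁅ x ⁆ ∪ (⁅ y ⁆ ∪ (⁅ z ⁆ ∪ ⊥)) ≡ ⊤ → x ≢ y × x ≢ z × y ≢ z
rainbow⇒distinct = from-yes (Fin.all? {n = 3} λ x → Fin.all? λ y → Fin.all? λ z →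
  ≡-dec Bool._≟_ (⁅ x ⁆ ∪ (⁅ y ⁆ ∪ (⁅ z ⁆ ∪ ⊥))) ⊤
    →-dec (¬? (x Fin.≟ y) ×-dec ¬? (x Fin.≟ z) ×-dec ¬? (y Fin.≟ z)))

Single : Subset 3 → Set
Single p = ∃[ x ] p ≡ ⁅ x ⁆

⊥-not-single : ¬ Single ⊥
⊥-not-single (x , ⊥≡⁅x⁆) with () ← trans (cong ∣_∣ ⊥≡⁅x⁆) (∣⁅x⁆∣≡1 x)

-- With three colours in all, two distinct ones leave only one choice. Equalities between labels of
-- distant vertices are obtained in this way.
third-unique : ∀ {p q r s} → Single p → Single q → Single r → Single s →
               p ≢ q → p ≢ r → q ≢ r → p ≢ s → q ≢ s → r ≡ s
third-unique (a , refl) (b , refl) (c , refl) (d , refl) p≢q p≢r q≢r p≢s q≢s =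
  cong ⁅_⁆ (only-three a b c d (p≢q ∘ cong ⁅_⁆) (p≢r ∘ cong ⁅_⁆) (q≢r ∘ cong ⁅_⁆)
                               (p≢s ∘ cong ⁅_⁆) (q≢s ∘ cong ⁅_⁆))
  where
  only-three : ∀ (a b c d : Fin 3) → a ≢ b → a ≢ c → b ≢ c → a ≢ d → b ≢ d → c ≡ d
  only-three = from-yes (Fin.all? {n = 3} λ a → Fin.all? λ b → Fin.all? λ c → Fin.all? λ d →
    ¬? (a Fin.≟ b) →-dec (¬? (a Fin.≟ c) →-dec (¬? (b Fin.≟ c) →-dec
    (¬? (a Fin.≟ d) →-dec (¬? (b Fin.≟ d) →-dec (c Fin.≟ d))))))

-- A 3-RDF of a cubic graph attaining the bound |V|/2, seen from a vertex with
-- label p and neighbouring labels x, y, z.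
data Tight (p x y z : Subset 3) : Set where
  empty    : p ≡ ⊥ → Single x → Single y → Single z → x ≢ y → x ≢ z → y ≢ z → Tight p x y z
  coloured : Single p → x ≡ ⊥ → y ≡ ⊥ → z ≡ ⊥ → Tight p x y z

-- The factor 3 balances the two cheapest ways to be served: one colour on the vertex itself, or
-- three colours spread over its neighbours.
load : (p x y z : Subset 3) → ℕ
load p x y z = ∣ x ∣ + (∣ y ∣ + ∣ z ∣) + 3 * ∣ p ∣

-- A nonempty label contributes 3 by itself. For an empty one the union of the neighbouring labels
-- has size 3, which is at most the sum of their sizes.
≤load : ∀ p x y z → (p ≡ ⊥ → x ∪ (y ∪ (z ∪ ⊥)) ≡ ⊤) → 3 ≤ load p x y z
≤load p x y z dom with ∣ p ∣ in eq
... | suc c = ≤-trans (m≤m*n 3 (suc c)) (m≤n+m _ _)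
... | zero  = begin
  3                                 ≡⟨ cong ∣_∣ (dom (∣p∣≡0⇒p≡⊥ p eq)) ⟨
  ∣ x ∪ (y ∪ (z ∪ ⊥)) ∣             ≤⟨ ∣p∪q∣≤∣p∣+∣q∣ x _ ⟩
  ∣ x ∣ + ∣ y ∪ (z ∪ ⊥) ∣           ≤⟨ +-monoʳ-≤ ∣ x ∣ (∣p∪q∣≤∣p∣+∣q∣ y _) ⟩
  ∣ x ∣ + (∣ y ∣ + ∣ z ∪ ⊥ ∣)       ≤⟨ +-monoʳ-≤ ∣ x ∣ (+-monoʳ-≤ ∣ y ∣ (∣p∪q∣≤∣p∣+∣q∣ z ⊥)) ⟩
  ∣ x ∣ + (∣ y ∣ + (∣ z ∣ + 0))     ≡⟨ cong (λ t → ∣ x ∣ + (∣ y ∣ + t)) (+-identityʳ ∣ z ∣) ⟩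
  ∣ x ∣ + (∣ y ∣ + ∣ z ∣)           ≡⟨ +-identityʳ _ ⟨
  ∣ x ∣ + (∣ y ∣ + ∣ z ∣) + 0       ∎
  where open ≤-Reasoning

load≡3⇒∣p∣≤1 : ∀ p x y z → load p x y z ≡ 3 → ∣ p ∣ ≤ 1
load≡3⇒∣p∣≤1 p x y z eq = *-cancelˡ-≤ 3 (≤-trans (m≤n+m (3 * ∣ p ∣) (∣ x ∣ + (∣ y ∣ + ∣ z ∣))) (≤-reflexive eq))

three-at-most-ones : ∀ {a b c} → a ≤ 1 → b ≤ 1 → c ≤ 1 → a + (b + c) ≡ 3 → a ≡ 1 × b ≡ 1 × c ≡ 1
three-at-most-ones (s≤s z≤n) (s≤s z≤n) (s≤s z≤n) _ = refl , refl , refl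
three-at-most-ones z≤n       z≤n       (s≤s z≤n) ()
three-at-most-ones z≤n       (s≤s z≤n) z≤n       ()
three-at-most-ones z≤n       (s≤s z≤n) (s≤s z≤n) ()
three-at-most-ones (s≤s z≤n) z≤n       (s≤s z≤n) ()
three-at-most-ones (s≤s z≤n) (s≤s z≤n) z≤n       ()

-- One colour on `p` uses up the whole load, so the neighbours are empty. If `p` is empty, three
-- sizes of at most 1 sum to 3, so all are 1, and domination makes the three colours distinct.
load≡3⇒tight : ∀ p x y z → (p ≡ ⊥ → x ∪ (y ∪ (z ∪ ⊥)) ≡ ⊤) → load p x y z ≡ 3 →
               ∣ x ∣ ≤ 1 → ∣ y ∣ ≤ 1 → ∣ z ∣ ≤ 1 → Tight p x y z
load≡3⇒tight p x y z dom eq x≤1 y≤1 z≤1 with ∣ p ∣ in ∣p∣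
... | suc (suc c) = contradiction (≤-trans (m≤n+m (3 * suc (suc c)) _) (≤-reflexive eq))
                                  (<⇒≱ (*-monoʳ-< 3 (s≤s (s≤s (z≤n {c})))))
... | suc zero    = coloured (∣p∣≡1⇒p≡⁅x⁆ p ∣p∣)
                             (∣p∣≡0⇒p≡⊥ x (m+n≡0⇒m≡0 ∣ x ∣ sum≡0))
                             (∣p∣≡0⇒p≡⊥ y (m+n≡0⇒m≡0 ∣ y ∣ (m+n≡0⇒n≡0 ∣ x ∣ sum≡0)))
                             (∣p∣≡0⇒p≡⊥ z (m+n≡0⇒n≡0 ∣ y ∣ (m+n≡0⇒n≡0 ∣ x ∣ sum≡0)))
  where
  sum≡0 : ∣ x ∣ + (∣ y ∣ + ∣ z ∣) ≡ 0
  sum≡0 = +-cancelʳ-≡ 3 _ 0 eq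
... | zero
  with ∣x∣ , ∣y∣ , ∣z∣ ← three-at-most-ones x≤1 y≤1 z≤1 (trans (sym (+-identityʳ _)) eq)
  with a , refl ← ∣p∣≡1⇒p≡⁅x⁆ x ∣x∣
  with b , refl ← ∣p∣≡1⇒p≡⁅x⁆ y ∣y∣
  with c , refl ← ∣p∣≡1⇒p≡⁅x⁆ z ∣z∣
  with a≢b , a≢c , b≢c ← rainbow⇒distinct a b c (dom (∣p∣≡0⇒p≡⊥ p ∣p∣))
  = empty (∣p∣≡0⇒p≡⊥ p ∣p∣) (a , refl) (b , refl) (c , refl)
          (a≢b ∘ ⁅⁆-injective) (a≢c ∘ ⁅⁆-injective) (b≢c ∘ ⁅⁆-injective)
  where
  ⁅⁆-injective : {u w : Fin 3} → ⁅ u ⁆ ≡ ⁅ w ⁆ → u ≡ w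
  ⁅⁆-injective {u} {w} eq = x∈⁅y⁆⇒x≡y w (subst (u ∈_) eq (x∈⁅x⁆ u))

-- Double counting in a graph with three neighbour maps.

neighbourList : (up down across : A → A) → A → List A
neighbourList up down across v = up v ∷ down v ∷ across v ∷ []

-- The maps are only asked to have the right set of values at each vertex. Two of them may coincide
-- there, as happens when the toroidal graph degenerates to a cycle.
module Trivalent
  (G : Graph)
  (up down across : Graph.V G → Graph.V G)
  (up-down       : ∀ v → up (down v) ≡ v)
  (down-up       : ∀ v → down (up v) ≡ v)
  (across-across : ∀ v → across (across v) ≡ v)
  (~⇒∈ : ∀ {v u} → Graph._~_ G v u → u ∈ₗ neighbourList up down across v)
  (∈⇒~ : ∀ {v u} → u ∈ₗ neighbourList up down across v → Graph._~_ G v u)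
  where

  open Graph G

  N : V → List V
  N = neighbourList up down across

  ∈-vertices : ∀ v → v ∈ₗ vertices
  ∈-vertices v = subst (_∈ₗ vertices) (Inverse.strictlyInverseˡ enum v)
                       (∈-tabulate⁺ (Inverse.from enum v))

  vertices-unique : Unique vertices
  vertices-unique = Unique.tabulate⁺ λ {i} {j} eq →
    trans (sym (Inverse.strictlyInverseʳ enum i))
          (trans (cong (Inverse.from enum) eq) (Inverse.strictlyInverseʳ enum j))

  ∈-neighbours⇒∈-N : ∀ {v u} → u ∈ₗ neighbours v → u ∈ₗ N v
  ∈-neighbours⇒∈-N {v} u∈ = ~⇒∈ (proj₂ (∈-filter⁻ (v ~?_) {xs = vertices} u∈))

  ∈-N⇒∈-neighbours : ∀ {v u} → u ∈ₗ N v → u ∈ₗ neighbours v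
  ∈-N⇒∈-neighbours {v} {u} u∈ = ∈-filter⁺ (v ~?_) (∈-vertices u) (∈⇒~ u∈)

  -- A union depends only on which labels occur, so order and repetition in `N v` do not matter.
  ⋃-neighbours : (f : V → Subset 3) (v : V) → ⋃ (map f (neighbours v)) ≡ ⋃ (map f (N v))
  ⋃-neighbours f v =
    ⊆-antisym (⋃-map-mono f ∈-neighbours⇒∈-N) (⋃-map-mono f {xs = N v} ∈-N⇒∈-neighbours)

  unique-N⇒cubic : (∀ v → Unique (N v)) → Cubic G
  unique-N⇒cubic N! v = ↭-length (unique∧set⇒↭ (Unique.filter⁺ (v ~?_) vertices-unique) (N! v)
                                               ∈-neighbours⇒∈-N ∈-N⇒∈-neighbours)

  ∑ : (V → ℕ) → ℕ
  ∑ g = sum (map g vertices)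

  ∑-permute : {σ τ : V → V} → (∀ v → σ (τ v) ≡ v) → (∀ v → τ (σ v) ≡ v) →
              (g : V → ℕ) → ∑ (g ∘ σ) ≡ ∑ g
  ∑-permute {σ} {τ} στ τσ g = begin
    sum (map (g ∘ σ) vertices)         ≡⟨ cong sum (map-∘ vertices) ⟩
    sum (map g (map σ vertices))       ≡⟨ sum-↭ (map⁺ g σ-vertices↭) ⟩
    sum (map g vertices)               ∎
    where
    open ≡-Reasoning
    σ-vertices↭ : map σ vertices ↭ vertices
    σ-vertices↭ = unique∧set⇒↭
      (Unique.map⁺ (λ {x} {y} eq → trans (sym (τσ x)) (trans (cong τ eq) (τσ y))) vertices-unique)
      vertices-unique
      (λ {x} _ → ∈-vertices x)
      (λ {x} _ → subst (_∈ₗ map σ vertices) (στ x) (∈-map⁺ σ (∈-vertices (τ x))))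

  loadAt : (V → Subset 3) → V → ℕ
  loadAt f v = load (f v) (f (up v)) (f (down v)) (f (across v))

  -- Each neighbour map permutes the vertices, so each of the three neighbour sums equals the plain
  -- sum.
  ∑-load : (f : V → Subset 3) → ∑ (loadAt f) ≡ 6 * weight G f
  ∑-load f = begin
    ∑ (λ v → g (up v) + (g (down v) + g (across v)) + 3 * g v)
      ≡⟨ sum-map-+ _ _ vertices ⟩
    ∑ (λ v → g (up v) + (g (down v) + g (across v))) + ∑ (λ v → 3 * g v)
      ≡⟨ cong₂ _+_ (sum-map-+ _ _ vertices) (sum-map-* 3 g vertices) ⟩
    ∑ (g ∘ up) + ∑ (λ v → g (down v) + g (across v)) + 3 * ∑ g
      ≡⟨ cong (λ s → ∑ (g ∘ up) + s + 3 * ∑ g) (sum-map-+ _ _ vertices) ⟩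
    ∑ (g ∘ up) + (∑ (g ∘ down) + ∑ (g ∘ across)) + 3 * ∑ g
      ≡⟨ cong (_+ 3 * ∑ g) (cong₂ _+_ (∑-permute up-down down-up g)
           (cong₂ _+_ (∑-permute down-up up-down g) (∑-permute across-across across-across g))) ⟩
    ∑ g + (∑ g + ∑ g) + 3 * ∑ g
      ≡⟨ solve 1 (λ w → w :+ (w :+ w) :+ con 3 :* w := con 6 :* w) refl (∑ g) ⟩
    6 * ∑ g ∎
    where
    open ≡-Reasoning
    open +-*-Solver
    g : V → ℕ
    g v = ∣ f v ∣

  length-vertices : length vertices ≡ order
  length-vertices = length-tabulate (Inverse.to enum)

  dominates : ∀ {f} → Is3RDF G f → ∀ v → f v ≡ ⊥ → ⋃ (map f (N v)) ≡ ⊤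
  dominates {f} rdf v fv≡⊥ = trans (sym (⋃-neighbours f v)) (rdf v fv≡⊥)

  3≤loadAt : ∀ {f} → Is3RDF G f → ∀ v → 3 ≤ loadAt f v
  3≤loadAt {f} rdf v = ≤load (f v) (f (up v)) (f (down v)) (f (across v)) (dominates rdf v)

  order*3≤6*weight : ∀ {f} → Is3RDF G f → order * 3 ≤ 6 * weight G f
  order*3≤6*weight {f} rdf = begin
    order * 3             ≡⟨ cong (_* 3) length-vertices ⟨
    length vertices * 3   ≤⟨ length*≤sum-map (3≤loadAt rdf) vertices ⟩
    ∑ (loadAt f)          ≡⟨ ∑-load f ⟩
    6 * weight G f        ∎
    where open ≤-Reasoning

  6*w≡[2*w]*3 : ∀ w → 6 * w ≡ 2 * w * 3
  6*w≡[2*w]*3 = solve 1 (λ w → con 6 :* w := con 2 :* w :* con 3) refl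
    where open +-*-Solver

  TightAt : (V → Subset 3) → V → Set
  TightAt f v = Tight (f v) (f (up v)) (f (down v)) (f (across v))

  -- Optimality is equality in the summed bound, hence equality at every vertex. The bound
  -- `load≡3⇒∣p∣≤1` is then available at the neighbours too.
  optimal⇒tight : ∀ {f} → Is3RDF G f → 2 * weight G f ≡ order → ∀ v → TightAt f v
  optimal⇒tight {f} rdf optimal v =
    load≡3⇒tight (f v) (f (up v)) (f (down v)) (f (across v)) (dominates rdf v) (load≡3 v)
      (∣f∣≤1 (up v)) (∣f∣≤1 (down v)) (∣f∣≤1 (across v))
    where
    open ≡-Reasoning
    load≡3 : ∀ u → loadAt f u ≡ 3
    load≡3 u = sum-map≡length* (3≤loadAt rdf) vertices (begin
      ∑ (loadAt f)          ≡⟨ ∑-load f ⟩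
      6 * weight G f        ≡⟨ 6*w≡[2*w]*3 (weight G f) ⟩
      2 * weight G f * 3    ≡⟨ cong (_* 3) (trans optimal (sym length-vertices)) ⟩
      length vertices * 3   ∎) (∈-vertices u)

    ∣f∣≤1 : ∀ u → ∣ f u ∣ ≤ 1
    ∣f∣≤1 u = load≡3⇒∣p∣≤1 (f u) (f (up u)) (f (down u)) (f (across u)) (load≡3 u)

  -- Constant load 3 turns the double count into `2 * weight G f ≡ order`, and the general lower
  -- bound gives minimality.
  balanced⇒3RDR : Cubic G → (f : V → Subset 3) → Is3RDF G f → (∀ v → loadAt f v ≡ 3) → Is3RDR G
  balanced⇒3RDR cubic f rdf load≡3 = record
    { cubic  = cubic
    ; γr3    = weight G f
    ; isγr3  = record
      { attained = f , rdf , refl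
      ; minimal  = λ f′ rdf′ → *-cancelˡ-≤ 6
          (≤-trans (≤-reflexive (trans (6*w≡[2*w]*3 (weight G f)) (cong (_* 3) halved)))
                   (order*3≤6*weight rdf′))
      }
    ; halved = halved
    }
    where
    open ≡-Reasoning
    halved : 2 * weight G f ≡ order
    halved = *-cancelʳ-≡ _ _ 3 (begin
      2 * weight G f * 3       ≡⟨ 6*w≡[2*w]*3 (weight G f) ⟨
      6 * weight G f           ≡⟨ ∑-load f ⟨
      ∑ (loadAt f)             ≡⟨ cong sum (map-cong load≡3 vertices) ⟩
      ∑ (λ _ → 3)              ≡⟨ sum-map-const 3 vertices ⟩
      length vertices * 3      ≡⟨ cong (_* 3) length-vertices ⟩
      order * 3                ∎)

  -- Colours forced by a tight labelling.

  module TightLabelling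
    -- This closes a hexagon: `v`, `up v`, `up (up v)`, `across (up (up v))`, `up (across v)`,
    -- `across v`.
    (across-up² : ∀ v → across (up (up v)) ≡ up (up (across v)))
    (f : V → Subset 3) (tight : ∀ v → TightAt f v)
    where

    single⇒up-empty : ∀ {v} → Single (f v) → f (up v) ≡ ⊥
    single⇒up-empty {v} s with tight v
    ... | empty fv≡⊥ _ _ _ _ _ _ = ⊥-elim (⊥-not-single (subst Single fv≡⊥ s))
    ... | coloured _ eq _ _      = eq

    single⇒down-empty : ∀ {v} → Single (f v) → f (down v) ≡ ⊥
    single⇒down-empty {v} s with tight v
    ... | empty fv≡⊥ _ _ _ _ _ _ = ⊥-elim (⊥-not-single (subst Single fv≡⊥ s))
    ... | coloured _ _ eq _      = eq

    record Rainbow (v : V) : Set where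
      field
        up-single     : Single (f (up v))
        down-single   : Single (f (down v))
        across-single : Single (f (across v))
        up≢down       : f (up v) ≢ f (down v)
        up≢across     : f (up v) ≢ f (across v)
        down≢across   : f (down v) ≢ f (across v)
    open Rainbow

    empty⇒rainbow : ∀ {v} → f v ≡ ⊥ → Rainbow v
    empty⇒rainbow {v} fv≡⊥ with tight v
    ... | empty _ s₁ s₂ s₃ d₁ d₂ d₃ = record
      { up-single = s₁ ; down-single = s₂ ; across-single = s₃
      ; up≢down = d₁ ; up≢across = d₂ ; down≢across = d₃ }
    ... | coloured s _ _ _ = ⊥-elim (⊥-not-single (subst Single fv≡⊥ s))

    -- The up-neighbour of across v is empty and adjacent to both across v and
    -- across (up² v); up v is adjacent to both v and up² v.
    module _ {v : V} (fv≡⊥ : f v ≡ ⊥) where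
      private
        v₂ w : V
        v₂ = up (up v)
        w  = up (across v)

        Rv : Rainbow v
        Rv = empty⇒rainbow fv≡⊥

        Rv₂ : Rainbow v₂
        Rv₂ = empty⇒rainbow (single⇒up-empty (up-single Rv))

        Rw : Rainbow w
        Rw = empty⇒rainbow (single⇒up-empty (across-single Rv))

        acrosses-differ : f (across v) ≢ f (across v₂)
        acrosses-differ eq = up≢down Rw (begin
          f (up w)         ≡⟨ cong f (across-up² v) ⟨
          f (across v₂)    ≡⟨ eq ⟨
          f (across v)     ≡⟨ cong f (down-up (across v)) ⟨
          f (down w)       ∎)
          where open ≡-Reasoning

        down-v₂ : f (down v₂) ≡ f (up v)
        down-v₂ = cong f (down-up (up v))

      -- Both labels avoid the colours of `up v` and `across v₂`: the vertices `v` and `w` show this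
      -- for `across v`, and `v₂` shows it for `up v₂`.
      empty-across≡up³ : f (across v) ≡ f (up (up (up v)))
      empty-across≡up³ = third-unique
        (up-single Rv) (across-single Rv₂) (across-single Rv) (up-single Rv₂)
        (λ eq → down≢across Rv₂ (trans down-v₂ eq))
        (up≢across Rv)
        (acrosses-differ ∘ sym)
        (λ eq → up≢down Rv₂ (sym (trans down-v₂ eq)))
        (up≢across Rv₂ ∘ sym)

      -- Both labels avoid the colours of `up v` and `across v`: `v₂` and `w` show this for
      -- `across v₂`, and `v` shows it for `down v`.
      empty-across-up²≡down : f (across v₂) ≡ f (down v)
      empty-across-up²≡down = third-unique
        (up-single Rv) (across-single Rv) (across-single Rv₂) (down-single Rv)
        (up≢across Rv)
        (λ eq → down≢across Rv₂ (trans down-v₂ eq))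
        acrosses-differ
        (up≢down Rv)
        (down≢across Rv ∘ sym)

    across≡up³ : ∀ v → f (across v) ≡ f (up (up (up v)))
    across≡up³ v with tight v
    ... | empty fv≡⊥ _ _ _ _ _ _ = empty-across≡up³ fv≡⊥
    -- Along a column coloured and empty vertices alternate, so here both sides are empty.
    ... | coloured s up≡⊥ _ across≡⊥ =
      trans across≡⊥ (sym (single⇒up-empty (up-single (empty⇒rainbow up≡⊥))))

    up⁶ : V → V
    up⁶ v = up (up (up (up (up (up v)))))

    -- The two preceding facts, applied at the empty vertices `up (up (up v))` and `up v`, both
    -- describe the colour of `across (up (up (up v)))`.
    single-up⁶ : ∀ {v} → Single (f v) → f (up⁶ v) ≡ f v
    single-up⁶ {v} s = begin
      f (up⁶ v)                   ≡⟨ empty-across≡up³ (single⇒up-empty (up-single R)) ⟨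
      f (across (up (up (up v)))) ≡⟨ empty-across-up²≡down up≡⊥ ⟩
      f (down (up v))             ≡⟨ cong f (down-up v) ⟩
      f v                         ∎
      where
      open ≡-Reasoning
      up≡⊥ : f (up v) ≡ ⊥
      up≡⊥ = single⇒up-empty s
      R : Rainbow (up v)
      R = empty⇒rainbow up≡⊥

    f-up⁶ : ∀ v → f (up⁶ v) ≡ f v
    f-up⁶ v with tight v
    ... | coloured s _ _ _ = single-up⁶ s
    -- The coloured vertex `up v` recurs six steps higher, and the vertex below that copy must be
    -- empty.
    ... | empty fv≡⊥ s _ _ _ _ _ = begin
      f (up⁶ v)              ≡⟨ cong f (down-up (up⁶ v)) ⟨
      f (down (up⁶ (up v)))  ≡⟨ single⇒down-empty (subst Single (sym (single-up⁶ s)) s) ⟩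
      ⊥                      ≡⟨ fv≡⊥ ⟨
      f v                    ∎
      where open ≡-Reasoning

    up-differs : ∀ {v} → Single (f v) → f (up v) ≢ f v
    up-differs s eq = ⊥-not-single (subst Single (trans (sym eq) (single⇒up-empty s)) s)

    -- Both vertices are neighbours of the empty vertex `up v`.
    up²-differs : ∀ {v} → Single (f v) → f (up (up v)) ≢ f v
    up²-differs {v} s eq = up≢down (empty⇒rainbow (single⇒up-empty s))
                                   (trans eq (cong f (sym (down-up v))))

    up²-single : ∀ {v} → Single (f v) → Single (f (up (up v)))
    up²-single s = up-single (empty⇒rainbow (single⇒up-empty s))

    up³-differs : ∀ {v} → Single (f v) → f (up (up (up v))) ≢ f v
    up³-differs s eq = ⊥-not-single (subst Single (trans (sym eq) (single⇒up-empty (up²-single s))) s)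

    -- Two further steps complete the period 6, so equality would contradict `up²-differs` four
    -- steps up.
    up⁴-differs : ∀ {v} → Single (f v) → f (up (up (up (up v)))) ≢ f v
    up⁴-differs s eq = up²-differs (up²-single (up²-single s)) (trans (single-up⁶ s) (sym eq))

    up⁵-differs : ∀ {v} → Single (f v) → f (up (up (up (up (up v))))) ≢ f v
    up⁵-differs s eq = ⊥-not-single
      (subst Single (trans (sym eq) (single⇒up-empty (up²-single (up²-single s)))) s)

    up^ : ℕ → V → V
    up^ zero    v = v
    up^ (suc k) v = up (up^ k v)

    -- Shifts by 1 to 5 are excluded one by one, and larger ones reduce by 6. The start must be
    -- coloured, since empty vertices recur every second step.
    up^-period : ∀ {v} k → Single (f v) → f (up^ k v) ≡ f v → k % 6 ≡ 0
    up^-period 0 _ _  = refl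
    up^-period 1 s eq = contradiction eq (up-differs s)
    up^-period 2 s eq = contradiction eq (up²-differs s)
    up^-period 3 s eq = contradiction eq (up³-differs s)
    up^-period 4 s eq = contradiction eq (up⁴-differs s)
    up^-period 5 s eq = contradiction eq (up⁵-differs s)
    up^-period {v} (suc (suc (suc (suc (suc (suc k)))))) s eq =
      up^-period k s (trans (sym (f-up⁶ (up^ k v))) eq)

    coloured-nearby : ∀ v → Single (f v) ⊎ Single (f (up v))
    coloured-nearby v with tight v
    ... | empty _ s _ _ _ _ _ = inj₂ s
    ... | coloured s _ _ _    = inj₁ s

  -- An equivariant map to ℤ₆ with steps +1, -1 and +3 is a covering of K₃,₃.
  module Covering
    (rank : V → ℕ)
    (rank-up     : ∀ v → rank (up v) ≈ 1 + rank v [mod 6 ])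
    (rank-across : ∀ v → rank (across v) ≈ 3 + rank v [mod 6 ])
    where

    rank-down : ∀ v → rank (down v) ≈ 5 + rank v [mod 6 ]
    rank-down v = begin
      -- Adding 5 completes the 1 of `rank-up` to 6, which vanishes modulo 6 by computation.
      (6 + rank (down v)) % 6    ≡⟨ %-congˡ-+ 5 (rank (up (down v))) (1 + rank (down v)) (rank-up (down v)) ⟨
      (5 + rank (up (down v))) % 6 ≡⟨ cong (λ u → (5 + rank u) % 6) (up-down v) ⟩
      (5 + rank v) % 6           ∎
      where open ≡-Reasoning

    -- An optimal 3-RDF of K₃,₃: the even residues form one side and carry the three colours, the
    -- odd ones stay empty.
    colour : ℕ → Subset 3
    colour 0 = ⁅ zero ⁆
    colour 1 = ⊥
    colour 2 = ⁅ suc zero ⁆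
    colour 3 = ⊥
    colour 4 = ⁅ suc (suc zero) ⁆
    colour 5 = ⊥
    colour (suc (suc (suc (suc (suc (suc r)))))) = colour r

    colour-% : ∀ r → colour (r % 6) ≡ colour r
    colour-% 0 = refl
    colour-% 1 = refl
    colour-% 2 = refl
    colour-% 3 = refl
    colour-% 4 = refl
    colour-% 5 = refl
    colour-% (suc (suc (suc (suc (suc (suc r)))))) = colour-% r

    colour-cong : ∀ r s → r ≈ s [mod 6 ] → colour r ≡ colour s
    colour-cong r s eq = trans (sym (colour-% r)) (trans (cong colour eq) (colour-% s))

    colour-up : ∀ v → colour (rank (up v)) ≡ colour (1 + rank v)
    colour-up v = colour-cong (rank (up v)) (1 + rank v) (rank-up v)

    colour-down : ∀ v → colour (rank (down v)) ≡ colour (5 + rank v)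
    colour-down v = colour-cong (rank (down v)) (5 + rank v) (rank-down v)

    colour-across : ∀ v → colour (rank (across v)) ≡ colour (3 + rank v)
    colour-across v = colour-cong (rank (across v)) (3 + rank v) (rank-across v)

    colour-dominates : ∀ r → colour r ≡ ⊥ →
                       colour (1 + r) ∪ (colour (5 + r) ∪ (colour (3 + r) ∪ ⊥)) ≡ ⊤
    colour-dominates 1 _ = refl
    colour-dominates 3 _ = refl
    colour-dominates 5 _ = refl
    colour-dominates (suc (suc (suc (suc (suc (suc r)))))) eq = colour-dominates r eq

    colour-load : ∀ r → load (colour r) (colour (1 + r)) (colour (5 + r)) (colour (3 + r)) ≡ 3
    colour-load 0 = refl
    colour-load 1 = refl
    colour-load 2 = refl
    colour-load 3 = refl
    colour-load 4 = refl
    colour-load 5 = refl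
    colour-load (suc (suc (suc (suc (suc (suc r)))))) = colour-load r

    shifts-distinct : ∀ r → (1 + r) % 6 ≢ (5 + r) % 6 × (1 + r) % 6 ≢ (3 + r) % 6
                          × (5 + r) % 6 ≢ (3 + r) % 6
    shifts-distinct 0 = (λ ()) , (λ ()) , (λ ())
    shifts-distinct 1 = (λ ()) , (λ ()) , (λ ())
    shifts-distinct 2 = (λ ()) , (λ ()) , (λ ())
    shifts-distinct 3 = (λ ()) , (λ ()) , (λ ())
    shifts-distinct 4 = (λ ()) , (λ ()) , (λ ())
    shifts-distinct 5 = (λ ()) , (λ ()) , (λ ())
    shifts-distinct (suc (suc (suc (suc (suc (suc r)))))) = shifts-distinct r

    labelling : V → Subset 3
    labelling v = colour (rank v)

    labelling-rdf : Is3RDF G labelling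
    labelling-rdf v eq
      rewrite ⋃-neighbours labelling v
            | colour-up v | colour-down v | colour-across v
      = colour-dominates (rank v) eq

    labelling-load : ∀ v → loadAt labelling v ≡ 3
    labelling-load v
      rewrite colour-up v | colour-down v | colour-across v
      = colour-load (rank v)

    -- The steps 1, 5 and 3 differ modulo 6, so the ranks separate the neighbours. Cubicity follows,
    -- and the degenerate cycle is excluded.
    unique-N : ∀ v → Unique (N v)
    unique-N v with d₁ , d₂ , d₃ ← shifts-distinct (rank v) =
      (separate (rank-up v) (rank-down v) d₁ ∷ separate (rank-up v) (rank-across v) d₂ ∷ [])
      ∷ (separate (rank-down v) (rank-across v) d₃ ∷ [])
      ∷ [] ∷ []
      where
      separate : ∀ {x y r s} → rank x % 6 ≡ r → rank y % 6 ≡ s → r ≢ s → x ≢ y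
      separate rx ry r≢s refl = r≢s (trans (sym rx) ry)

    covering⇒3RDR : Is3RDR G
    covering⇒3RDR = balanced⇒3RDR (unique-N⇒cubic unique-N) labelling labelling-rdf labelling-load

-- Parities of natural numbers.

parity-cong : ∀ a b → a ≈ b [mod 2 ] → parity a ≡ parity b
parity-cong a b eq = trans (sym (parity-% a)) (trans (cong parity eq) (parity-% b))
  where
  parity-% : ∀ a → parity (a % 2) ≡ parity a
  parity-% 0             = refl
  parity-% 1             = refl
  parity-% (suc (suc a)) = parity-% a

parity-injective : ∀ a b → parity a ≡ parity b → a ≈ b [mod 2 ]
parity-injective 0 0 _ = refl
parity-injective 1 1 _ = refl
parity-injective (suc (suc a)) b eq = parity-injective a b eq
parity-injective 0 (suc (suc b)) eq = parity-injective 0 b eq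
parity-injective 1 (suc (suc b)) eq = parity-injective 1 b eq

parity-suc : ∀ a → parity (suc a) ≡ opp (parity a)
parity-suc a = sym (ℙ.⁻¹-selfInverse (ℙ.suc-homo-⁻¹ a))

-- Translates the edge condition that `i + 1` and `j` agree modulo 2 into oddness of `i + j`, the
-- form used by `side`.
parity-+-1ℙ⁺ : ∀ a b → parity (suc a) ≡ parity b → parity (a + b) ≡ 1ℙ
parity-+-1ℙ⁺ a b eq rewrite ℙ.+-homo-+ a b | sym eq | parity-suc a with parity a
... | 0ℙ = refl
... | 1ℙ = refl

parity-+-1ℙ⁻ : ∀ a b → parity (a + b) ≡ 1ℙ → parity (suc a) ≡ parity b
parity-+-1ℙ⁻ a b eq rewrite ℙ.+-homo-+ a b | parity-suc a with parity a | parity b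
... | 0ℙ | 1ℙ = refl
... | 1ℙ | 0ℙ = refl

-- Neighbour maps and bipartition of the honeycomb toroidal graph.

module Torus (m′ n ℓ : ℕ) (adm : Admissible (suc m′) n ℓ) where
  open Admissible adm

  instance
    n≢0 : NonZero n
    n≢0 = >-nonZero (≤-trans (s≤s z≤n) n≥4)

  private
    m : ℕ
    m = suc m′

  G : Graph
  G = HTG m n ℓ adm

  open Graph G using (V; _~_)

  shift : Fin n → ℕ → Fin n
  shift j d = (toℕ j + d) mod n

  toℕ-shift : ∀ j d → toℕ (shift j d) ≡ (toℕ j + d) % n
  toℕ-shift j d = Fin.toℕ-fromℕ< (m%n<n (toℕ j + d) n)

  shift-+ : ∀ j d e → shift (shift j d) e ≡ shift j (d + e)
  shift-+ j d e = Fin.toℕ-injective (begin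
    toℕ (shift (shift j d) e)       ≡⟨ toℕ-shift (shift j d) e ⟩
    (toℕ (shift j d) + e) % n       ≡⟨ cong (λ t → (t + e) % n) (toℕ-shift j d) ⟩
    ((toℕ j + d) % n + e) % n       ≡⟨ %-distribˡ-+ ((toℕ j + d) % n) e n ⟩
    ((toℕ j + d) % n % n + e % n) % n ≡⟨ cong (λ t → (t + e % n) % n) (m%n%n≡m%n (toℕ j + d) n) ⟩
    ((toℕ j + d) % n + e % n) % n   ≡⟨ %-distribˡ-+ (toℕ j + d) e n ⟨
    (toℕ j + d + e) % n             ≡⟨ cong (_% n) (+-assoc (toℕ j) d e) ⟩
    (toℕ j + (d + e)) % n           ≡⟨ toℕ-shift j (d + e) ⟨
    toℕ (shift j (d + e))           ∎)
    where open ≡-Reasoning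

  shift-comm : ∀ j d e → shift (shift j d) e ≡ shift (shift j e) d
  shift-comm j d e =
    trans (shift-+ j d e) (trans (cong (shift j) (+-comm d e)) (sym (shift-+ j e d)))

  shift-0 : ∀ j → shift j 0 ≡ j
  shift-0 j = Fin.toℕ-injective (begin
    toℕ (shift j 0)   ≡⟨ toℕ-shift j 0 ⟩
    (toℕ j + 0) % n   ≡⟨ cong (_% n) (+-identityʳ (toℕ j)) ⟩
    toℕ j % n         ≡⟨ m<n⇒m%n≡m (Fin.toℕ<n j) ⟩
    toℕ j             ∎)
    where open ≡-Reasoning

  shift-n : ∀ j → shift j n ≡ j
  shift-n j = Fin.toℕ-injective (begin
    toℕ (shift j n)   ≡⟨ toℕ-shift j n ⟩
    (toℕ j + n) % n   ≡⟨ [m+n]%n≡m%n (toℕ j) n ⟩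
    toℕ j % n         ≡⟨ m<n⇒m%n≡m (Fin.toℕ<n j) ⟩
    toℕ j             ∎)
    where open ≡-Reasoning

  shift-inverse : ∀ j {d e} → d + e ≡ n → shift (shift j d) e ≡ j
  shift-inverse j {d} {e} eq = trans (shift-+ j d e) (trans (cong (shift j) eq) (shift-n j))

  -- Wrapping around `n` is invisible modulo a divisor of `n`; this is applied with `k` equal to 2
  -- and 6.
  toℕ-shift-mod : ∀ k .{{_ : NonZero k}} → k ∣ n → ∀ j d → toℕ (shift j d) ≈ toℕ j + d [mod k ]
  toℕ-shift-mod k k∣n j d =
    trans (cong (_% k) (toℕ-shift j d)) (m∣n⇒o%n%m≡o%m k n (toℕ j + d) k∣n)

  1≤n : 1 ≤ n
  1≤n = ≤-trans (s≤s z≤n) n≥4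

  ℓ≤n : ℓ ≤ n
  ℓ≤n = ≤-trans ℓ≤n/2 (m/n≤m n 2)

  up down : V → V
  up   (i , j) = i , shift j 1
  down (i , j) = i , shift j (n ∸ 1)

  up-down : ∀ v → up (down v) ≡ v
  up-down (i , j) = cong (i ,_) (shift-inverse j (m∸n+n≡m 1≤n))

  down-up : ∀ v → down (up v) ≡ v
  down-up (i , j) = cong (i ,_) (shift-inverse j (m+[n∸m]≡n 1≤n))

  rightView : {i : Fin m} → View i → Fin n → V
  rightView ‵fromℕ           j = zero , shift j ℓ
  rightView (‵inj₁ {i = i} _) j = suc i , j

  -- Defined at every vertex, whether or not the edge is present, so that they are mutually inverse
  -- bijections commuting with `up`. The choice between them is left to `side`.
  right left : V → V
  right (i , j) = rightView (view i) j
  left (zero  , j) = fromℕ m′ , shift j (n ∸ ℓ)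
  left (suc i , j) = inject₁ i , j

  right-fromℕ : ∀ j → right (fromℕ m′ , j) ≡ (zero , shift j ℓ)
  right-fromℕ j rewrite view-fromℕ m′ = refl

  right-inject₁ : ∀ i j → right (inject₁ i , j) ≡ (suc i , j)
  right-inject₁ i j rewrite view-inject₁ i = refl

  right-elim : (P : V → V → Set) →
               (∀ j → P (fromℕ m′ , j) (zero , shift j ℓ)) →
               (∀ i j → P (inject₁ i , j) (suc i , j)) →
               ∀ v → P v (right v)
  right-elim P last inner (i , j) with view i
  ... | ‵fromℕ           = last j
  ... | ‵inj₁ {i = i′} _ = inner i′ j

  right-left : ∀ v → right (left v) ≡ v
  right-left (zero  , j) = trans (right-fromℕ _) (cong (zero ,_) (shift-inverse j (m∸n+n≡m ℓ≤n)))
  right-left (suc i , j) = right-inject₁ i j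

  left-right : ∀ v → left (right v) ≡ v
  left-right = right-elim (λ v u → left u ≡ v)
    (λ j → cong (fromℕ m′ ,_) (shift-inverse j (m+[n∸m]≡n ℓ≤n)))
    (λ i j → refl)

  right-up : ∀ v → right (up v) ≡ up (right v)
  right-up = right-elim (λ v u → right (up v) ≡ up u)
    (λ j → trans (right-fromℕ _) (cong (zero ,_) (shift-comm j 1 ℓ)))
    (λ i j → right-inject₁ i _)

  left-up : ∀ v → left (up v) ≡ up (left v)
  left-up v = begin
    left (up v)                ≡⟨ cong (left ∘ up) (right-left v) ⟨
    left (up (right (left v))) ≡⟨ cong left (right-up (left v)) ⟨
    left (right (up (left v))) ≡⟨ left-right (up (left v)) ⟩
    up (left v)                ∎
    where open ≡-Reasoning

  -- The classes of the bipartition: the third edge goes to the right when `i + j` is odd and to the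
  -- left when it is even.
  side : V → Parity
  side (i , j) = parity (toℕ i + toℕ j)

  side-up : ∀ v → side (up v) ≡ opp (side v)
  side-up (i , j) = begin
    parity (toℕ i + toℕ (shift j 1))           ≡⟨ ℙ.+-homo-+ (toℕ i) _ ⟩
    parity (toℕ i) ⊕ parity (toℕ (shift j 1))
      ≡⟨ cong (parity (toℕ i) ⊕_) (parity-cong (toℕ (shift j 1)) (toℕ j + 1) (toℕ-shift-mod 2 n-even j 1)) ⟩
    parity (toℕ i) ⊕ parity (toℕ j + 1)        ≡⟨ ℙ.+-homo-+ (toℕ i) _ ⟨
    parity (toℕ i + (toℕ j + 1))               ≡⟨ cong parity (+-assoc (toℕ i) (toℕ j) 1) ⟨
    parity (toℕ i + toℕ j + 1)                 ≡⟨ cong parity (+-comm (toℕ i + toℕ j) 1) ⟩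
    parity (suc (toℕ i + toℕ j))               ≡⟨ parity-suc (toℕ i + toℕ j) ⟩
    opp (parity (toℕ i + toℕ j))               ∎
    where open ≡-Reasoning

  side-up² : ∀ v → side (up (up v)) ≡ side v
  side-up² v = trans (side-up (up v)) (trans (cong opp (side-up v)) (ℙ.⁻¹-involutive (side v)))

  side-right : ∀ v → side (right v) ≡ opp (side v)
  side-right = right-elim (λ v u → side u ≡ opp (side v))
    (λ j → begin
      parity (toℕ (shift j ℓ))              ≡⟨ parity-cong (toℕ (shift j ℓ)) (toℕ j + ℓ) (toℕ-shift-mod 2 n-even j ℓ) ⟩
      parity (toℕ j + ℓ)                    ≡⟨ ℙ.+-homo-+ (toℕ j) ℓ ⟩
      -- Since `ℓ` has the parity of `m`, the jump changes `i + j` by an odd amount although the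
      -- column falls from `m′` to 0.
      parity (toℕ j) ⊕ parity ℓ             ≡⟨ cong (parity (toℕ j) ⊕_) (parity-cong ℓ m ℓ≡m) ⟩
      parity (toℕ j) ⊕ parity m             ≡⟨ ℙ.+-homo-+ (toℕ j) m ⟨
      parity (toℕ j + m)                    ≡⟨ cong parity (+-comm (toℕ j) m) ⟩
      parity (suc (m′ + toℕ j))             ≡⟨ parity-suc (m′ + toℕ j) ⟩
      opp (parity (m′ + toℕ j))             ≡⟨ cong (λ t → opp (parity (t + toℕ j))) (Fin.toℕ-fromℕ m′) ⟨
      opp (parity (toℕ (fromℕ m′) + toℕ j)) ∎)
    (λ i j → trans (parity-suc (toℕ i + toℕ j))
                   (cong (λ t → opp (parity (t + toℕ j))) (sym (Fin.toℕ-inject₁ i))))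
    where open ≡-Reasoning

  side-left : ∀ v → side (left v) ≡ opp (side v)
  side-left v = sym (begin
    opp (side v)                ≡⟨ cong (opp ∘ side) (right-left v) ⟨
    opp (side (right (left v))) ≡⟨ cong opp (side-right (left v)) ⟩
    opp (opp (side (left v)))   ≡⟨ ℙ.⁻¹-involutive (side (left v)) ⟩
    side (left v)               ∎)
    where open ≡-Reasoning

  sideways : Parity → V → V
  sideways 0ℙ = left
  sideways 1ℙ = right

  across : V → V
  across v = sideways (side v) v

  across-odd : ∀ {v} → side v ≡ 1ℙ → across v ≡ right v
  across-odd {v} eq = cong (λ p → sideways p v) eq

  across-even : ∀ {v} → side v ≡ 0ℙ → across v ≡ left v
  across-even {v} eq = cong (λ p → sideways p v) eq

  -- A horizontal move changes the side, so the next one goes back.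
  across-across : ∀ v → across (across v) ≡ v
  across-across v with side v in eq
  ... | 0ℙ = trans (across-odd (trans (side-left v) (cong opp eq))) (right-left v)
  ... | 1ℙ = trans (across-even (trans (side-right v) (cong opp eq))) (left-right v)

  -- Two vertical steps preserve the side, so the same horizontal map acts at both ends.
  across-up² : ∀ v → across (up (up v)) ≡ up (up (across v))
  across-up² v rewrite side-up² v with side v
  ... | 0ℙ = trans (left-up (up v)) (cong up (left-up v))
  ... | 1ℙ = trans (right-up (up v)) (cong up (right-up v))

  Edge⇒ : ∀ {v u} → Edge m n ℓ v u → u ≡ up v ⊎ (side v ≡ 1ℙ × u ≡ right v)
  Edge⇒ (inj₁ (refl , refl)) = inj₁ refl
  Edge⇒ {i , j} {i′ , _} (inj₂ (inj₁ (i′≡i+1 , refl , i+1≡j))) with view i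
  -- No column follows the last one: `i′` would have to be `m`.
  ... | ‵fromℕ = contradiction (Fin.toℕ<n i′)
    (≤⇒≯ (≤-reflexive (trans (cong suc (sym (Fin.toℕ-fromℕ m′)))
                             (trans (+-comm 1 _) (sym i′≡i+1)))))
  ... | ‵inj₁ {i = k} _ = inj₂
    ( parity-+-1ℙ⁺ (toℕ (inject₁ k)) (toℕ j)
        (trans (cong parity (+-comm 1 (toℕ (inject₁ k)))) (parity-cong (toℕ (inject₁ k) + 1) (toℕ j) i+1≡j))
    , cong (_, j) (Fin.toℕ-injective
        (trans i′≡i+1 (trans (+-comm _ 1) (cong suc (Fin.toℕ-inject₁ k))))) )
  Edge⇒ {i , j} {zero , _} (inj₂ (inj₂ (i+1≡m , _ , refl , j≡m))) = inj₂
    ( parity-+-1ℙ⁺ (toℕ i) (toℕ j)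
        (trans (cong parity (trans (+-comm 1 (toℕ i)) i+1≡m)) (sym (parity-cong (toℕ j) m j≡m)))
    , sym (trans (cong (λ t → right (t , j)) i≡last) (right-fromℕ j)) )
    where
    i≡last : i ≡ fromℕ m′
    i≡last = Fin.toℕ-injective
      (trans (suc-injective (trans (+-comm 1 (toℕ i)) i+1≡m)) (sym (Fin.toℕ-fromℕ m′)))

  Edge-right : ∀ v → side v ≡ 1ℙ → Edge m n ℓ v (right v)
  Edge-right = right-elim (λ v u → side v ≡ 1ℙ → Edge m n ℓ v u)
    (λ j odd → inj₂ (inj₂
      ( trans (+-comm _ 1) (cong suc (Fin.toℕ-fromℕ m′))
      , refl , refl
      , parity-injective (toℕ j) m
          (trans (sym (parity-+-1ℙ⁻ (toℕ (fromℕ m′)) (toℕ j) odd))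
                 (cong (λ t → parity (suc t)) (Fin.toℕ-fromℕ m′))) )))
    (λ i j odd → inj₂ (inj₁
      ( trans (cong suc (sym (Fin.toℕ-inject₁ i))) (+-comm 1 _)
      , refl
      , parity-injective (toℕ (inject₁ i) + 1) (toℕ j)
          (trans (cong parity (+-comm (toℕ (inject₁ i)) 1))
                 (parity-+-1ℙ⁻ (toℕ (inject₁ i)) (toℕ j) odd)) )))

  ~⇒∈ : ∀ {v u} → v ~ u → u ∈ₗ neighbourList up down across v
  ~⇒∈ {v} {u} (inj₁ e) with Edge⇒ e
  ... | inj₁ refl         = here refl
  ... | inj₂ (odd , refl) = there (there (here (sym (across-odd odd))))
  ~⇒∈ {v} {u} (inj₂ e) with Edge⇒ e
  ... | inj₁ refl         = there (here (sym (down-up u)))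
  ... | inj₂ (odd , refl) = there (there (here (sym
    (trans (across-even (trans (side-right u) (cong opp odd))) (left-right u)))))

  ∈⇒~ : ∀ {v u} → u ∈ₗ neighbourList up down across v → v ~ u
  ∈⇒~ {v} (here refl)         = inj₁ (inj₁ (refl , refl))
  ∈⇒~ {v} (there (here refl)) = inj₂ (inj₁ (refl , sym (cong proj₂ (up-down v))))
  ∈⇒~ {v} (there (there (here refl))) with side v in eq
  ... | 1ℙ = inj₁ (Edge-right v eq)
  ... | 0ℙ = inj₂ (subst (Edge m n ℓ (left v)) (right-left v)
                         (Edge-right (left v) (trans (side-left v) (cong opp eq))))

  open Trivalent G up down across up-down down-up across-across ~⇒∈ ∈⇒~

  -- Sufficiency: the covering of K₃,₃.

  covered⇒3RDR : 6 ∣ n → ℓ ≈ 3 * m [mod 6 ] → Is3RDR G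
  covered⇒3RDR 6∣n ℓ≡3m = Covering.covering⇒3RDR rank rank-up rank-across
    where
    -- Vertical wrapping respects the rank because 6 divides `n`. The jump loses `3 * m′` and gains
    -- `ℓ`, which is `3 * m` modulo 6, so it raises the rank by 3 like any other step to the right.
    rank : V → ℕ
    rank (i , j) = toℕ j + 3 * toℕ i

    rank-up : ∀ v → rank (up v) ≈ 1 + rank v [mod 6 ]
    rank-up (i , j) = begin
      (toℕ (shift j 1) + 3 * toℕ i) % 6   ≡⟨ cong (_% 6) (+-comm _ (3 * toℕ i)) ⟩
      (3 * toℕ i + toℕ (shift j 1)) % 6   ≡⟨ %-congˡ-+ (3 * toℕ i) _ (toℕ j + 1) (toℕ-shift-mod 6 6∣n j 1) ⟩
      (3 * toℕ i + (toℕ j + 1)) % 6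
        ≡⟨ cong (_% 6) (solve 2 (λ a b → a :+ (b :+ con 1) := con 1 :+ (b :+ a)) refl (3 * toℕ i) (toℕ j)) ⟩
      (1 + (toℕ j + 3 * toℕ i)) % 6       ∎
      where
      open ≡-Reasoning
      open +-*-Solver

    rank-right : ∀ v → rank (right v) ≈ 3 + rank v [mod 6 ]
    rank-right = right-elim (λ v u → rank u ≈ 3 + rank v [mod 6 ])
      (λ j → begin
        (toℕ (shift j ℓ) + 0) % 6          ≡⟨ cong (_% 6) (+-identityʳ (toℕ (shift j ℓ))) ⟩
        toℕ (shift j ℓ) % 6                ≡⟨ toℕ-shift-mod 6 6∣n j ℓ ⟩
        (toℕ j + ℓ) % 6                    ≡⟨ %-congˡ-+ (toℕ j) ℓ (3 * m) ℓ≡3m ⟩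
        (toℕ j + 3 * m) % 6                ≡⟨ cong (_% 6) (three-more (toℕ j) m′) ⟩
        (3 + (toℕ j + 3 * m′)) % 6         ≡⟨ cong (λ t → (3 + (toℕ j + 3 * t)) % 6) (Fin.toℕ-fromℕ m′) ⟨
        (3 + (toℕ j + 3 * toℕ (fromℕ m′))) % 6 ∎)
      (λ i j → begin
        (toℕ j + 3 * suc (toℕ i)) % 6          ≡⟨ cong (_% 6) (three-more (toℕ j) (toℕ i)) ⟩
        (3 + (toℕ j + 3 * toℕ i)) % 6          ≡⟨ cong (λ t → (3 + (toℕ j + 3 * t)) % 6) (Fin.toℕ-inject₁ i) ⟨
        (3 + (toℕ j + 3 * toℕ (inject₁ i))) % 6 ∎)
      where
      open ≡-Reasoning
      open +-*-Solver
      three-more : ∀ a b → a + 3 * suc b ≡ 3 + (a + 3 * b)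
      three-more = solve 2 (λ a b → a :+ con 3 :* (con 1 :+ b) := con 3 :+ (a :+ con 3 :* b)) refl

    -- 3 is its own negative modulo 6, so the inverse of `right` also adds 3.
    rank-left : ∀ v → rank (left v) ≈ 3 + rank v [mod 6 ]
    rank-left v = begin
      (6 + rank (left v)) % 6         ≡⟨ %-congˡ-+ 3 (rank (right (left v))) (3 + rank (left v)) (rank-right (left v)) ⟨
      (3 + rank (right (left v))) % 6 ≡⟨ cong (λ u → (3 + rank u) % 6) (right-left v) ⟩
      (3 + rank v) % 6                ∎
      where open ≡-Reasoning

    rank-across : ∀ v → rank (across v) ≈ 3 + rank v [mod 6 ]
    rank-across v with side v
    ... | 0ℙ = rank-left v
    ... | 1ℙ = rank-right v

  -- Necessity: following the colours around the torus.

  module _ (f : V → Subset 3) (tight : ∀ v → TightAt f v) where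
    open TightLabelling across-up² f tight

    up^≡shift : ∀ k i j → up^ k (i , j) ≡ (i , shift j k)
    up^≡shift zero    i j = cong (i ,_) (sym (shift-0 j))
    up^≡shift (suc k) i j = trans (cong up (up^≡shift k i j))
      (cong (i ,_) (trans (shift-+ j k 1) (cong (shift j) (+-comm k 1))))

    -- If v is even then right v is odd, but up³ (right v) is even again and its
    -- left neighbour is up³ v.
    right≡up³ : ∀ v → f (right v) ≡ f (up (up (up v)))
    right≡up³ v with side v in eq
    ... | 1ℙ = trans (cong f (sym (across-odd eq))) (across≡up³ v)
    ... | 0ℙ = begin
      f (right v)                    ≡⟨ f-up⁶ (right v) ⟨
      f (up³ (up³ (right v)))        ≡⟨ across≡up³ (up³ (right v)) ⟨
      f (across (up³ (right v)))     ≡⟨ cong f (across-even even) ⟩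
      f (left (up³ (right v)))       ≡⟨ cong f (left-up³ (right v)) ⟩
      f (up³ (left (right v)))       ≡⟨ cong (f ∘ up³) (left-right v) ⟩
      f (up³ v)                      ∎
      where
      open ≡-Reasoning
      up³ : V → V
      up³ u = up (up (up u))
      left-up³ : ∀ u → left (up³ u) ≡ up³ (left u)
      left-up³ u = trans (left-up (up (up u)))
        (cong up (trans (left-up (up u)) (cong up (left-up u))))
      even : side (up³ (right v)) ≡ 0ℙ
      even = begin
        side (up³ (right v))    ≡⟨ side-up² (up (right v)) ⟩
        side (up (right v))     ≡⟨ side-up (right v) ⟩
        opp (side (right v))    ≡⟨ cong opp (side-right v) ⟩
        opp (opp (side v))      ≡⟨ ℙ.⁻¹-involutive (side v) ⟩
        side v                  ≡⟨ eq ⟩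
        0ℙ                      ∎

    right≡shift : ∀ i j → f (right (i , j)) ≡ f (i , shift j 3)
    right≡shift i j = trans (right≡up³ (i , j)) (cong f (up^≡shift 3 i j))

    shift-3* : ∀ j {a b} → a ≡ b → shift (shift j 3) (3 * a) ≡ shift j (3 * suc b)
    shift-3* j {a} refl = trans (shift-+ j 3 (3 * a)) (cong (shift j) (sym (*-suc 3 a)))

    column : ∀ i j → f (i , j) ≡ f (zero , shift j (3 * toℕ i))
    column = <-weakInduction (λ i → ∀ j → f (i , j) ≡ f (zero , shift j (3 * toℕ i)))
      (λ j → cong (λ t → f (zero , t)) (sym (shift-0 j)))
      (λ i ih j → begin
        f (suc i , j)                                          ≡⟨ cong f (right-inject₁ i j) ⟨
        f (right (inject₁ i , j))                              ≡⟨ right≡shift (inject₁ i) j ⟩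
        f (inject₁ i , shift j 3)                              ≡⟨ ih (shift j 3) ⟩
        f (zero , shift (shift j 3) (3 * toℕ (inject₁ i)))     ≡⟨ cong (λ t → f (zero , t)) (shift-3* j (Fin.toℕ-inject₁ i)) ⟩
        f (zero , shift j (3 * suc (toℕ i)))                   ∎)
      where open ≡-Reasoning

    -- The right neighbour of the last column is read in two ways: as the jump back to column 0, and
    -- as one more shift by 3.
    once-around : ∀ j → f (zero , shift j ℓ) ≡ f (zero , shift j (3 * m))
    once-around j = begin
      f (zero , shift j ℓ)                                ≡⟨ cong f (right-fromℕ j) ⟨
      f (right (fromℕ m′ , j))                            ≡⟨ right≡shift (fromℕ m′) j ⟩
      f (fromℕ m′ , shift j 3)                            ≡⟨ column (fromℕ m′) (shift j 3) ⟩
      f (zero , shift (shift j 3) (3 * toℕ (fromℕ m′)))   ≡⟨ cong (λ t → f (zero , t)) (shift-3* j (Fin.toℕ-fromℕ m′)) ⟩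
      f (zero , shift j (3 * m))                          ∎
      where open ≡-Reasoning

    period : ∀ {j} → Single (f (zero , j)) → ∀ k → f (zero , shift j k) ≡ f (zero , j) → k % 6 ≡ 0
    period {j} s k eq = up^-period k s (trans (cong f (up^≡shift k zero j)) eq)

    f-shift-6* : ∀ k i j → f (i , shift j (k * 6)) ≡ f (i , j)
    f-shift-6* zero    i j = cong (λ t → f (i , t)) (shift-0 j)
    f-shift-6* (suc k) i j = begin
      f (i , shift j (6 + k * 6))           ≡⟨ cong f (up^≡shift (6 + k * 6) i j) ⟨
      f (up⁶ (up^ (k * 6) (i , j)))         ≡⟨ f-up⁶ _ ⟩
      f (up^ (k * 6) (i , j))               ≡⟨ cong f (up^≡shift (k * 6) i j) ⟩
      f (i , shift j (k * 6))               ≡⟨ f-shift-6* k i j ⟩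
      f (i , j)                             ∎
      where open ≡-Reasoning

    6∣n∧6∣3m+ℓ : n ≈ 0 [mod 6 ] × 3 * m + ℓ ≈ 0 [mod 6 ]
    -- The starting row is arbitrary; either it or the next one is coloured.
    6∣n∧6∣3m+ℓ = [ from , from ]′ (coloured-nearby (zero , 0 mod n))
      where
      open ≡-Reasoning
      from : ∀ {j} → Single (f (zero , j)) → n ≈ 0 [mod 6 ] × 3 * m + ℓ ≈ 0 [mod 6 ]
      from {j} s =
          period s n (cong (λ t → f (zero , t)) (shift-n j))
        -- Starting `once-around` at `shift j (3 * m)` yields a total shift by `m * 6`, hence a
        -- return to the coloured row `j`, as `period` requires.
        , period s (3 * m + ℓ) (begin
            f (zero , shift j (3 * m + ℓ))               ≡⟨ cong (λ t → f (zero , t)) (shift-+ j (3 * m) ℓ) ⟨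
            f (zero , shift (shift j (3 * m)) ℓ)         ≡⟨ once-around (shift j (3 * m)) ⟩
            f (zero , shift (shift j (3 * m)) (3 * m))   ≡⟨ cong (λ t → f (zero , t)) (shift-+ j (3 * m) (3 * m)) ⟩
            f (zero , shift j (3 * m + 3 * m))           ≡⟨ cong (λ t → f (zero , shift j t)) (3m+3m≡m*6 m) ⟩
            f (zero , shift j (m * 6))                   ≡⟨ f-shift-6* m zero j ⟩
            f (zero , j)                                 ∎)
        where
        open +-*-Solver
        3m+3m≡m*6 : ∀ m → 3 * m + 3 * m ≡ m * 6
        3m+3m≡m*6 = solve 1 (λ m → con 3 :* m :+ con 3 :* m := m :* con 6) refl

  3RDR⇒divisible : Is3RDR G → n ≈ 0 [mod 6 ] × 3 * m + ℓ ≈ 0 [mod 6 ]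
  3RDR⇒divisible rdr with f , rdf , refl ← Isγr3.attained (Is3RDR.isγr3 rdr) =
    6∣n∧6∣3m+ℓ f (optimal⇒tight rdf (Is3RDR.halved rdr))

-- Arithmetic of the condition and the equivalence.

even⇒3m : ∀ m → m ≈ 0 [mod 2 ] → 3 * m ≈ 0 [mod 6 ]
even⇒3m 0             _  = refl
even⇒3m (suc (suc m)) eq = trans (cong (_% 6) (*-distribˡ-+ 3 2 m)) (even⇒3m m eq)

odd⇒3m : ∀ m → m ≈ 1 [mod 2 ] → 3 * m ≈ 3 [mod 6 ]
odd⇒3m 1             _  = refl
odd⇒3m (suc (suc m)) eq = trans (cong (_% 6) (*-distribˡ-+ 3 2 m)) (odd⇒3m m eq)

Condition : (m n ℓ : ℕ) → Set
Condition m n ℓ = (m ≈ 0 [mod 2 ] × n ≈ 0 [mod 6 ] × ℓ ≈ 0 [mod 6 ])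
                ⊎ (m ≈ 1 [mod 2 ] × n ≈ 0 [mod 6 ] × ℓ ≈ 3 [mod 6 ])

divisible⇒condition : ∀ m n ℓ → n ≈ 0 [mod 6 ] → 3 * m + ℓ ≈ 0 [mod 6 ] → Condition m n ℓ
divisible⇒condition m n ℓ 6∣n 6∣3m+ℓ with m % 2 in eq | m%n<n m 2
... | 0 | _ = inj₁ (refl , 6∣n , trans (sym (%-congʳ-+ ℓ (3 * m) 0 (even⇒3m m eq))) 6∣3m+ℓ)
-- Adding 3 to the congruence of `3 + ℓ` with 0 gives `6 + ℓ` on the left, where the 6 vanishes by
-- computation.
... | 1 | _ = inj₂ (refl , 6∣n ,
  %-congˡ-+ 3 (3 + ℓ) 0 (trans (sym (%-congʳ-+ ℓ (3 * m) 3 (odd⇒3m m eq))) 6∣3m+ℓ))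
... | suc (suc _) | s≤s (s≤s ())

condition⇒covered : ∀ m n ℓ → Condition m n ℓ → 6 ∣ n × ℓ ≈ 3 * m [mod 6 ]
condition⇒covered m n ℓ (inj₁ (m-even , 6∣n , ℓ≡0)) =
  m%n≡0⇒n∣m n 6 6∣n , trans ℓ≡0 (sym (even⇒3m m m-even))
condition⇒covered m n ℓ (inj₂ (m-odd , 6∣n , ℓ≡3)) =
  m%n≡0⇒n∣m n 6 6∣n , trans ℓ≡3 (sym (odd⇒3m m m-odd))

theorem4p5 : (m n ℓ : ℕ) (adm : Admissible m n ℓ) →
    Is3RDR (HTG m n ℓ adm) ⇔
    ( (m ≈ 0 [mod 2 ] × n ≈ 0 [mod 6 ] × ℓ ≈ 0 [mod 6 ])
    ⊎ (m ≈ 1 [mod 2 ] × n ≈ 0 [mod 6 ] × ℓ ≈ 3 [mod 6 ]) )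
theorem4p5 zero     n ℓ adm with () ← Admissible.m≥1 adm
theorem4p5 (suc m′) n ℓ adm = mk⇔
  (λ rdr → let 6∣n , 6∣3m+ℓ = 3RDR⇒divisible rdr in divisible⇒condition (suc m′) n ℓ 6∣n 6∣3m+ℓ)
  (λ cond → let 6∣n , ℓ≡3m = condition⇒covered (suc m′) n ℓ cond in covered⇒3RDR 6∣n ℓ≡3m)
  where open Torus m′ n ℓ adm
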